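{- Let $\mathbb T$ be the theory of bounded distributive lattices and assume (SQCP), i.e. $\mathbb I[\mathsf i]$ is quasi-coherent. If $A$ is an $\mathbb I$-algebra such that both $A$ and $A[\mathsf i]$ are quasi-coherent, then the path space $A^{\mathbb I}$ classifies the canonical order on $A$: the map $A^{\mathbb I}\to A\times A$, $\alpha\mapsto(\alpha(0),\alpha(1))$, is an embedding whose image is $\{(a,b)\mid a\le_A b\}$.
   Context: We work in intensional type theory with function extensionality. $\mathbb I$ is a bounded distributive lattice; an $\mathbb I$-algebra is a bounded distributive lattice $A$ with a homomorphism $\mathbb I\to A$. $\operatorname{Spec}A:=\mathbb I\text{ - }\mathbf{Alg}(A,\mathbb I)$; $\mathcal O X:=\mathbb I^X$ with pointwise operations. $A$ is quasi-coherent if $\iota_A:A\to\mathcal O\operatorname{Spec}A$, $a\mapsto(x\mapsto x(a))$, is an isomorphism. $A[\mathsf i]$ is the free $\mathbb I$-algebra over $A$ on one generator. The canonical order is $a\le_A b\Leftrightarrow a\wedge b=a$. -}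

module Defs where

open import Level using (Level; 0ℓ; suc)
open import Data.Product using (Σ; Σ-syntax; _×_; _,_; proj₁; proj₂)
open import Relation.Binary.PropositionalEquality using (_≡_)
open import Axiom.Extensionality.Propositional using (Extensionality)

record BDLattice : Set₁ where
  infixr 7 _∧_
  infixr 6 _∨_
  field
    Carrier : Set
    _∧_ _∨_ : Carrier → Carrier → Carrier
    ⊥ ⊤ : Carrier
    ∧-assoc : ∀ x y z → (x ∧ y) ∧ z ≡ x ∧ (y ∧ z)
    ∨-assoc : ∀ x y z → (x ∨ y) ∨ z ≡ x ∨ (y ∨ z)
    ∧-comm : ∀ x y → x ∧ y ≡ y ∧ x
    ∨-comm : ∀ x y → x ∨ y ≡ y ∨ x
    ∧-absorbs-∨ : ∀ x y → x ∧ (x ∨ y) ≡ x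
    ∨-absorbs-∧ : ∀ x y → x ∨ (x ∧ y) ≡ x
    ∧-distribˡ-∨ : ∀ x y z → x ∧ (y ∨ z) ≡ (x ∧ y) ∨ (x ∧ z)
    ∧-identityʳ : ∀ x → x ∧ ⊤ ≡ x
    ∨-identityʳ : ∀ x → x ∨ ⊥ ≡ x

  _≤_ : Carrier → Carrier → Set
  a ≤ b = a ∧ b ≡ a

open BDLattice public using (Carrier)

record IsHom (L M : BDLattice) (f : Carrier L → Carrier M) : Set where
  private
    module L = BDLattice L
    module M = BDLattice M
  field
    pres-∧ : ∀ x y → f (x L.∧ y) ≡ f x M.∧ f y
    pres-∨ : ∀ x y → f (x L.∨ y) ≡ f x M.∨ f y
    pres-⊥ : f L.⊥ ≡ M.⊥
    pres-⊤ : f L.⊤ ≡ M.⊤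

Hom : BDLattice → BDLattice → Set
Hom L M = Σ (Carrier L → Carrier M) (IsHom L M)

module _ (𝕀 : BDLattice) where

  record Alg : Set₁ where
    field
      lat : BDLattice
      str : Hom 𝕀 lat

    car : Set
    car = Carrier lat

  open Alg public

  AlgHom : Alg → Alg → Set
  AlgHom A B = Σ (Hom (lat A) (lat B))
    λ f → ∀ (i : Carrier 𝕀) → proj₁ f (proj₁ (str A) i) ≡ proj₁ (str B) i

  𝕀Alg : Alg
  𝕀Alg = record
    { lat = 𝕀
    ; str = (λ i → i) , record { pres-∧ = λ _ _ → _≡_.refl ; pres-∨ = λ _ _ → _≡_.refl
                                ; pres-⊥ = _≡_.refl ; pres-⊤ = _≡_.refl } }

  Spec : Alg → Set
  Spec A = AlgHom A 𝕀Alg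

  -- 𝒪 X := 𝕀^X (its carrier; operations pointwise)
  𝒪 : Set → Set
  𝒪 X = X → Carrier 𝕀

  ι : (A : Alg) → car A → 𝒪 (Spec A)
  ι A a x = proj₁ (proj₁ x) a

  -- A is quasi-coherent: ι_A is an isomorphism (it is always an 𝕀-algebra
  -- homomorphism for the pointwise structure, so being an isomorphism means
  -- having a two-sided inverse).
  IsQuasiCoherent : Alg → Set
  IsQuasiCoherent A =
    Σ[ g ∈ (𝒪 (Spec A) → car A) ]
      ((∀ a → g (ι A a) ≡ a) × (∀ φ → ι A (g φ) ≡ φ))

  IsFreeOneGen : (A B : Alg) → AlgHom A B → car B → Set₁
  IsFreeOneGen A B η i =
    (C : Alg) (f : AlgHom A C) (c : car C) →
      Σ[ h ∈ AlgHom B C ]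
        ( (∀ a → proj₁ (proj₁ h) (proj₁ (proj₁ η) a) ≡ proj₁ (proj₁ f) a)
        × (proj₁ (proj₁ h) i ≡ c)
        × ((h' : AlgHom B C)
             → (∀ a → proj₁ (proj₁ h') (proj₁ (proj₁ η) a) ≡ proj₁ (proj₁ f) a)
             → proj₁ (proj₁ h') i ≡ c
             → ∀ b → proj₁ (proj₁ h') b ≡ proj₁ (proj₁ h) b) )

  -- (SQCP): 𝕀[i] is quasi-coherent, for (any, hence the) free 𝕀-algebra on
  -- one generator over 𝕀.
  SQCP : Set₁
  SQCP = (B : Alg) (η : AlgHom 𝕀Alg B) (i : car B) →
           IsFreeOneGen 𝕀Alg B η i → IsQuasiCoherent B

fiber : {X Y : Set} → (X → Y) → Y → Set
fiber {X} f y = Σ[ x ∈ X ] f x ≡ y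

IsEmbedding : {X Y : Set} → (X → Y) → Set
IsEmbedding {Y = Y} f = ∀ (y : Y) (p q : fiber f y) → p ≡ q

FunExt : Set₁
FunExt = Extensionality 0ℓ 0ℓ

{-# OPTIONS --safe #-}
module Submission where

open import Defs
open import Data.Product using (Σ; Σ-syntax; _×_; _,_; proj₁; proj₂)
open import Relation.Binary.PropositionalEquality using (_≡_)
open import Relation.Binary.PropositionalEquality
  using (refl; sym; trans; cong; cong₂; cong-app; isEquivalence; module ≡-Reasoning)
open import Axiom.UniquenessOfIdentityProofs.WithK using (uip)
open import Function.Base using (_∘_)
open import Function.Bundles using (_⇔_; mk⇔)
open import Algebra.Bundles using (CommutativeSemigroup)
open import Algebra.Lattice.Bundles using (Lattice)
import Algebra.Consequences.Propositional as Consequences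
import Algebra.Lattice.Properties.Lattice as LatticeProperties
import Algebra.Properties.CommutativeSemigroup as CommutativeSemigroupProperties

open ≡-Reasoning

-- An element of the free algebra A[i] is uniquely of the form a ∨ (b ∧ i)
-- with a ≤ b: the pairs a ≤ b form a subalgebra of A × A, whose map to A[i]
-- has a section over A sending i to (⊥ , ⊤), by freeness. Since
-- Spec A[i] ≅ Spec A × 𝕀, quasi-coherence of A and A[i] identifies A[i] with
-- A^𝕀, so every path in A is t ↦ a ∨ (b ∧ t) with a ≤ b, and its endpoints
-- are a and b.

-- Distributive lattice identities and lattice polynomials in one variable.

module BDLatticeProperties (L : BDLattice) where
  open BDLattice L public hiding (Carrier)

  lattice : Lattice _ _
  lattice = record
    { isLattice = record
      { isEquivalence = isEquivalence
      ; ∨-comm = ∨-comm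
      ; ∨-assoc = ∨-assoc
      ; ∨-cong = cong₂ _∨_
      ; ∧-comm = ∧-comm
      ; ∧-assoc = ∧-assoc
      ; ∧-cong = cong₂ _∧_
      ; absorptive = ∨-absorbs-∧ , ∧-absorbs-∨
      }
    }

  open LatticeProperties lattice public
    using (∧-idem; ∧-isSemigroup; ∨-isSemigroup)

  ∧-commutativeSemigroup : CommutativeSemigroup _ _
  ∧-commutativeSemigroup = record
    { isCommutativeSemigroup = record { isSemigroup = ∧-isSemigroup ; comm = ∧-comm } }

  ∨-commutativeSemigroup : CommutativeSemigroup _ _
  ∨-commutativeSemigroup = record
    { isCommutativeSemigroup = record { isSemigroup = ∨-isSemigroup ; comm = ∨-comm } }

  open CommutativeSemigroupProperties ∧-commutativeSemigroup public
    using () renaming (interchange to ∧-interchange)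
  open CommutativeSemigroupProperties ∨-commutativeSemigroup public
    using () renaming (interchange to ∨-interchange)

  ∧-distribʳ-∨ : ∀ x y z → (y ∨ z) ∧ x ≡ (y ∧ x) ∨ (z ∧ x)
  ∧-distribʳ-∨ = Consequences.comm∧distrˡ⇒distrʳ ∧-comm ∧-distribˡ-∨

  ∨-distribˡ-∧ : ∀ x y z → x ∨ (y ∧ z) ≡ (x ∨ y) ∧ (x ∨ z)
  ∨-distribˡ-∧ = Consequences.distrib∧absorbs⇒distribˡ
    (cong₂ _∨_) ∨-assoc ∧-comm ∨-absorbs-∧ ∧-absorbs-∨ (∧-distribˡ-∨ , ∧-distribʳ-∨)

  ∨-distribʳ-∧ : ∀ x y z → (y ∧ z) ∨ x ≡ (y ∨ x) ∧ (z ∨ x)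
  ∨-distribʳ-∧ = Consequences.comm∧distrˡ⇒distrʳ ∨-comm ∨-distribˡ-∧

  ∨-identityˡ : ∀ x → ⊥ ∨ x ≡ x
  ∨-identityˡ x = trans (∨-comm ⊥ x) (∨-identityʳ x)

  ∧-identityˡ : ∀ x → ⊤ ∧ x ≡ x
  ∧-identityˡ x = trans (∧-comm ⊤ x) (∧-identityʳ x)

  ∧-zeroˡ : ∀ x → ⊥ ∧ x ≡ ⊥
  ∧-zeroˡ x = trans (cong (⊥ ∧_) (sym (∨-identityˡ x))) (∧-absorbs-∨ ⊥ x)

  ∧-zeroʳ : ∀ x → x ∧ ⊥ ≡ ⊥
  ∧-zeroʳ x = trans (∧-comm x ⊥) (∧-zeroˡ x)

  ≤⇒∨≡ : ∀ {a b} → a ≤ b → a ∨ b ≡ b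
  ≤⇒∨≡ {a} {b} a≤b = begin
    a ∨ b        ≡⟨ cong (_∨ b) (sym a≤b) ⟩
    (a ∧ b) ∨ b  ≡⟨ ∨-comm (a ∧ b) b ⟩
    b ∨ (a ∧ b)  ≡⟨ cong (b ∨_) (∧-comm a b) ⟩
    b ∨ (b ∧ a)  ≡⟨ ∨-absorbs-∧ b a ⟩
    b            ∎

  ∨≡⇒≤ : ∀ {a b} → a ∨ b ≡ b → a ≤ b
  ∨≡⇒≤ {a} {b} e = trans (cong (a ∧_) (sym e)) (∧-absorbs-∨ a b)

  ∧-mono-≤ : ∀ {a b c d} → a ≤ b → c ≤ d → (a ∧ c) ≤ (b ∧ d)
  ∧-mono-≤ a≤b c≤d = trans (∧-interchange _ _ _ _) (cong₂ _∧_ a≤b c≤d)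

  ∨-mono-≤ : ∀ {a b c d} → a ≤ b → c ≤ d → (a ∨ c) ≤ (b ∨ d)
  ∨-mono-≤ a≤b c≤d =
    ∨≡⇒≤ (trans (∨-interchange _ _ _ _) (cong₂ _∨_ (≤⇒∨≡ a≤b) (≤⇒∨≡ c≤d)))

  -- The normal form of a lattice polynomial in `t`. It is defined for all `a` and `b`, and runs
  -- from `a` at `⊥` to `a ∨ b` at `⊤`; the latter is `b` exactly when `a ≤ b`.
  segment : Carrier L → Carrier L → Carrier L → Carrier L
  segment a b t = a ∨ (b ∧ t)

  segment-⊥ : ∀ a b → segment a b ⊥ ≡ a
  segment-⊥ a b = trans (cong (a ∨_) (∧-zeroʳ b)) (∨-identityʳ a)

  segment-⊤ : ∀ {a b} → a ≤ b → segment a b ⊤ ≡ b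
  segment-⊤ {a} {b} a≤b = trans (cong (a ∨_) (∧-identityʳ b)) (≤⇒∨≡ a≤b)

  -- Distributivity gives `(a ∨ b) ∧ (a ∨ t)`, and the order collapses the first factor. This form,
  -- a meet of joins, lets `∧-interchange` regroup products.
  segment-modular : ∀ {a b} t → a ≤ b → segment a b t ≡ b ∧ (a ∨ t)
  segment-modular {a} {b} t a≤b =
    trans (∨-distribˡ-∧ a b t) (cong (_∧ (a ∨ t)) (≤⇒∨≡ a≤b))

  segment-∨ : ∀ a b c d t →
    segment (a ∨ c) (b ∨ d) t ≡ segment a b t ∨ segment c d t
  segment-∨ a b c d t =
    trans (cong ((a ∨ c) ∨_) (∧-distribʳ-∨ t b d)) (∨-interchange a c (b ∧ t) (d ∧ t))

  -- Expanding the right side yields the cross terms `a ∧ d ∧ t` and `b ∧ c ∧ t`; the order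
  -- hypotheses put both below `b ∧ d ∧ t`.
  segment-∧ : ∀ {a b c d} t → a ≤ b → c ≤ d →
    segment (a ∧ c) (b ∧ d) t ≡ segment a b t ∧ segment c d t
  segment-∧ {a} {b} {c} {d} t a≤b c≤d = begin
    segment (a ∧ c) (b ∧ d) t          ≡⟨ segment-modular t (∧-mono-≤ a≤b c≤d) ⟩
    (b ∧ d) ∧ ((a ∧ c) ∨ t)            ≡⟨ cong ((b ∧ d) ∧_) (∨-distribʳ-∧ t a c) ⟩
    (b ∧ d) ∧ ((a ∨ t) ∧ (c ∨ t))      ≡⟨ ∧-interchange b d (a ∨ t) (c ∨ t) ⟩
    (b ∧ (a ∨ t)) ∧ (d ∧ (c ∨ t))      ≡⟨ cong₂ _∧_ (segment-modular t a≤b) (segment-modular t c≤d) ⟨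
    segment a b t ∧ segment c d t      ∎

module _ {L M : BDLattice} where
  private
    module L = BDLatticeProperties L
    module M = BDLatticeProperties M

  hom-segment : (f : Hom L M) → ∀ a b t →
    proj₁ f (L.segment a b t) ≡ M.segment (proj₁ f a) (proj₁ f b) (proj₁ f t)
  hom-segment (f , isHom) a b t =
    trans (pres-∨ a (b L.∧ t)) (cong (f a M.∨_) (pres-∧ b t))
    where open IsHom isHom

_∘ʰ_ : {L M N : BDLattice} → Hom M N → Hom L M → Hom L N
(g , gHom) ∘ʰ (f , fHom) = g ∘ f , record
  { pres-∧ = λ x y → trans (cong g (F.pres-∧ x y)) (G.pres-∧ (f x) (f y))
  ; pres-∨ = λ x y → trans (cong g (F.pres-∨ x y)) (G.pres-∨ (f x) (f y))
  ; pres-⊥ = trans (cong g F.pres-⊥) G.pres-⊥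
  ; pres-⊤ = trans (cong g F.pres-⊤) G.pres-⊤
  }
  where
  module F = IsHom fHom
  module G = IsHom gHom

-- The lattice of ordered pairs, a concrete model of the free algebra.

module OrderedPairs (L : BDLattice) where
  open BDLatticeProperties L

  OrderedPair : Set
  OrderedPair = Σ[ (a , b) ∈ Carrier L × Carrier L ] a ≤ b

  -- The order is an equation between elements, so `uip` makes its proofs irrelevant and the lattice
  -- laws reduce to components.
  OrderedPair-≡ : {p q : OrderedPair} →
    proj₁ (proj₁ p) ≡ proj₁ (proj₁ q) → proj₂ (proj₁ p) ≡ proj₂ (proj₁ q) → p ≡ q
  OrderedPair-≡ refl refl = cong (_ ,_) (uip _ _)

  orderedPairs : BDLattice
  orderedPairs = record
    { Carrier = OrderedPair
    ; _∧_ = λ ((a , b) , a≤b) ((c , d) , c≤d) → (a ∧ c , b ∧ d) , ∧-mono-≤ a≤b c≤d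
    ; _∨_ = λ ((a , b) , a≤b) ((c , d) , c≤d) → (a ∨ c , b ∨ d) , ∨-mono-≤ a≤b c≤d
    ; ⊥ = (⊥ , ⊥) , ∧-idem ⊥
    ; ⊤ = (⊤ , ⊤) , ∧-idem ⊤
    ; ∧-assoc = λ _ _ _ → OrderedPair-≡ (∧-assoc _ _ _) (∧-assoc _ _ _)
    ; ∨-assoc = λ _ _ _ → OrderedPair-≡ (∨-assoc _ _ _) (∨-assoc _ _ _)
    ; ∧-comm = λ _ _ → OrderedPair-≡ (∧-comm _ _) (∧-comm _ _)
    ; ∨-comm = λ _ _ → OrderedPair-≡ (∨-comm _ _) (∨-comm _ _)
    ; ∧-absorbs-∨ = λ _ _ → OrderedPair-≡ (∧-absorbs-∨ _ _) (∧-absorbs-∨ _ _)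
    ; ∨-absorbs-∧ = λ _ _ → OrderedPair-≡ (∨-absorbs-∧ _ _) (∨-absorbs-∧ _ _)
    ; ∧-distribˡ-∨ = λ _ _ _ → OrderedPair-≡ (∧-distribˡ-∨ _ _ _) (∧-distribˡ-∨ _ _ _)
    ; ∧-identityʳ = λ _ → OrderedPair-≡ (∧-identityʳ _) (∧-identityʳ _)
    ; ∨-identityʳ = λ _ → OrderedPair-≡ (∨-identityʳ _) (∨-identityʳ _)
    }

  diagonal : Hom L orderedPairs
  diagonal = (λ a → (a , a) , ∧-idem a) , record
    { pres-∧ = λ _ _ → OrderedPair-≡ refl refl
    ; pres-∨ = λ _ _ → OrderedPair-≡ refl refl
    ; pres-⊥ = refl
    ; pres-⊤ = refl
    }

  -- Plays the generator, since `⊥ ∨ (⊤ ∧ t)` is `t`.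
  ⊥≤⊤ : OrderedPair
  ⊥≤⊤ = (⊥ , ⊤) , ∧-zeroˡ ⊤

  module _ {M : BDLattice} (f : Hom L M) (t : Carrier M) where
    private
      module M = BDLatticeProperties M
      open IsHom (proj₂ f)

      map-≤ : ∀ {a b} → a ≤ b → proj₁ f a M.≤ proj₁ f b
      map-≤ a≤b = trans (sym (pres-∧ _ _)) (cong (proj₁ f) a≤b)

    -- Evaluation of polynomials at `t`, with coefficients moved along `f`. Meets are preserved
    -- because the pairs are ordered; the bounds are diagonal pairs, on which absorption removes
    -- `t`.
    segmentHom : Hom orderedPairs M
    segmentHom = (λ ((a , b) , _) → M.segment (proj₁ f a) (proj₁ f b) t) , record
      { pres-∧ = λ ((a , b) , a≤b) ((c , d) , c≤d) →
          trans (cong₂ (λ x y → M.segment x y t) (pres-∧ a c) (pres-∧ b d))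
                (M.segment-∧ t (map-≤ a≤b) (map-≤ c≤d))
      ; pres-∨ = λ ((a , b) , _) ((c , d) , _) →
          trans (cong₂ (λ x y → M.segment x y t) (pres-∨ a c) (pres-∨ b d))
                (M.segment-∨ _ _ _ _ t)
      ; pres-⊥ = trans (cong₂ (λ x y → M.segment x y t) pres-⊥ pres-⊥)
                       (M.∨-absorbs-∧ M.⊥ t)
      ; pres-⊤ = trans (cong₂ (λ x y → M.segment x y t) pres-⊤ pres-⊤)
                       (M.∨-absorbs-∧ M.⊤ t)
      }

    segmentHom-diagonal : ∀ a → proj₁ segmentHom (proj₁ diagonal a) ≡ proj₁ f a
    segmentHom-diagonal a = M.∨-absorbs-∧ (proj₁ f a) t

    segmentHom-⊥≤⊤ : proj₁ segmentHom ⊥≤⊤ ≡ t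
    segmentHom-⊥≤⊤ = begin
      M.segment (proj₁ f ⊥) (proj₁ f ⊤) t  ≡⟨ cong₂ (λ x y → M.segment x y t) pres-⊥ pres-⊤ ⟩
      M.⊥ M.∨ (M.⊤ M.∧ t)                  ≡⟨ M.∨-identityˡ _ ⟩
      M.⊤ M.∧ t                            ≡⟨ M.∧-identityˡ t ⟩
      t                                    ∎

-- Algebras over the interval and normal forms in the free algebra.

module _ {𝕀 : BDLattice} where

  _∘ᵃ_ : {A B C : Alg 𝕀} → AlgHom 𝕀 B C → AlgHom 𝕀 A B → AlgHom 𝕀 A C
  (g , g-str) ∘ᵃ (f , f-str) =
    g ∘ʰ f , λ t → trans (cong (proj₁ g) (f-str t)) (g-str t)

  idᵃ : {A : Alg 𝕀} → AlgHom 𝕀 A A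
  idᵃ = ((λ a → a) , record { pres-∧ = λ _ _ → refl ; pres-∨ = λ _ _ → refl
                            ; pres-⊥ = refl ; pres-⊤ = refl })
      , λ _ → refl

  -- Points of the spectrum separate elements: `g` recovers an element from its values.
  ι-injective : FunExt → (A : Alg 𝕀) → IsQuasiCoherent 𝕀 A →
    ∀ {a b} → (∀ x → ι 𝕀 A a x ≡ ι 𝕀 A b x) → a ≡ b
  ι-injective funExt A (g , g∘ι , _) {a} {b} e =
    trans (sym (g∘ι a)) (trans (cong g (funExt e)) (g∘ι b))

  module _ (A Ai : Alg 𝕀) (η : AlgHom 𝕀 A Ai) (i : car Ai)
           (free : IsFreeOneGen 𝕀 A Ai η i) where
    open BDLatticeProperties (lat A) using (_≤_)
    open OrderedPairs (lat A)
    private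
      module Ai = BDLatticeProperties (lat Ai)
      η₀ = proj₁ (proj₁ η)

    -- The round trip `k∘h` through ordered pairs fixes the constants and the generator, hence every
    -- `p`; the coefficients are the components of `h` at `p`.
    normal-form : ∀ p → Σ[ (a , b) ∈ car A × car A ] a ≤ b × p ≡ Ai.segment (η₀ a) (η₀ b) i
    normal-form p =
      let (a , b) , a≤b = proj₁ (proj₁ h) p in
      -- Uniqueness compares a map with the endomorphism chosen by `free`, so the identity and `k∘h`
      -- are each compared with that one.
      (a , b) , a≤b , trans (unique (idᵃ {Ai}) (λ _ → refl) refl p) (sym (unique k∘h k∘h∘η k∘h∘i p))
      where
      pairs : Alg 𝕀
      pairs = record { lat = orderedPairs ; str = diagonal ∘ʰ str A }

      k : AlgHom 𝕀 pairs Ai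
      k = segmentHom (proj₁ η) i , λ t → trans (segmentHom-diagonal (proj₁ η) i _) (proj₂ η t)

      toPairs = free pairs (diagonal , λ _ → refl) ⊥≤⊤

      h : AlgHom 𝕀 Ai pairs
      h = proj₁ toPairs

      k∘h : AlgHom 𝕀 Ai Ai
      k∘h = _∘ᵃ_ {Ai} {pairs} {Ai} k h

      k∘h∘η : ∀ a → proj₁ (proj₁ k∘h) (η₀ a) ≡ η₀ a
      k∘h∘η a = trans (cong (proj₁ (proj₁ k)) (proj₁ (proj₂ toPairs) a))
                      (segmentHom-diagonal (proj₁ η) i a)

      k∘h∘i : proj₁ (proj₁ k∘h) i ≡ i
      k∘h∘i = trans (cong (proj₁ (proj₁ k)) (proj₁ (proj₂ (proj₂ toPairs))))
                    (segmentHom-⊥≤⊤ (proj₁ η) i)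

      unique = proj₂ (proj₂ (proj₂ (free Ai η i)))

  -- Paths in a quasi-coherent algebra.

  module _ (A : Alg 𝕀) where
    open BDLatticeProperties (lat A)
    private
      module 𝕀 = BDLatticeProperties 𝕀
      str₀ = proj₁ (str A)
      open IsHom (proj₂ (str A))

    path : car A → car A → Carrier 𝕀 → car A
    path a b t = segment a b (str₀ t)

    path-⊥ : ∀ a b → path a b 𝕀.⊥ ≡ a
    path-⊥ a b = trans (cong (segment a b) pres-⊥) (segment-⊥ a b)

    path-⊤ : ∀ {a b} → a ≤ b → path a b 𝕀.⊤ ≡ b
    path-⊤ a≤b = trans (cong (segment _ _) pres-⊤) (segment-⊤ a≤b)

    module _ (funExt : FunExt) (A-qc : IsQuasiCoherent 𝕀 A)
             (Ai : Alg 𝕀) (η : AlgHom 𝕀 A Ai) (i : car Ai) (free : IsFreeOneGen 𝕀 A Ai η i)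
             (Ai-qc : IsQuasiCoherent 𝕀 Ai) where
      private
        module Ai = BDLatticeProperties (lat Ai)
        η₀ = proj₁ (proj₁ η)

      -- Quasi-coherence of `Ai` turns `α`, read as a function on its spectrum, into an element `p`
      -- with a normal form; quasi-coherence of `A` lets the resulting equation be tested at points.
      every-path-is-segment : (α : Carrier 𝕀 → car A) →
        Σ[ (a , b) ∈ car A × car A ] a ≤ b × (∀ t → α t ≡ path a b t)
      every-path-is-segment α =
        (a , b) , a≤b , λ t → ι-injective funExt A A-qc (α≡path-at t)
        where
        -- α transposed along Spec Ai ≅ Spec A × 𝕀, y ↦ (y ∘ η , y i).
        φ : Spec 𝕀 Ai → Carrier 𝕀
        φ y = ι 𝕀 A (α (proj₁ (proj₁ y) i)) (_∘ᵃ_ {A} {Ai} {𝕀Alg 𝕀} y η)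

        p = proj₁ Ai-qc φ
        form = normal-form A Ai η i free p
        a = proj₁ (proj₁ form)
        b = proj₂ (proj₁ form)
        a≤b = proj₁ (proj₂ form)

        α≡path-at : ∀ t (x : Spec 𝕀 A) → ι 𝕀 A (α t) x ≡ ι 𝕀 A (path a b t) x
        α≡path-at t x = begin
          -- Both sides are compared through the value of `p` at `y`, the point of `Spec Ai` that
          -- extends `x` and sends `i` to `t`.
          x₀ (α t)                                    ≡⟨ cong (x₀ ∘ α) y-i ⟨
          x₀ (α (y₀ i))                               ≡⟨ y-η (α (y₀ i)) ⟨
          φ y                                         ≡⟨ cong-app (proj₂ (proj₂ Ai-qc) φ) y ⟨
          y₀ p                                        ≡⟨ cong y₀ (proj₂ (proj₂ form)) ⟩
          y₀ (Ai.segment (η₀ a) (η₀ b) i)             ≡⟨ hom-segment (proj₁ y) (η₀ a) (η₀ b) i ⟩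
          𝕀.segment (y₀ (η₀ a)) (y₀ (η₀ b)) (y₀ i)    ≡⟨ cong₂ (λ u v → 𝕀.segment u v (y₀ i)) (y-η a) (y-η b) ⟩
          𝕀.segment (x₀ a) (x₀ b) (y₀ i)              ≡⟨ cong (𝕀.segment (x₀ a) (x₀ b)) y-i ⟩
          -- As an algebra map to `𝕀`, `x` sends the constant `str₀ t` back to `t`.
          𝕀.segment (x₀ a) (x₀ b) t                   ≡⟨ cong (𝕀.segment (x₀ a) (x₀ b)) (proj₂ x t) ⟨
          𝕀.segment (x₀ a) (x₀ b) (x₀ (str₀ t))       ≡⟨ hom-segment (proj₁ x) a b (str₀ t) ⟨
          x₀ (path a b t)                             ∎
          where
          x₀ = proj₁ (proj₁ x)
          extension = free (𝕀Alg 𝕀) x t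
          y = proj₁ extension
          y₀ = proj₁ (proj₁ y)
          y-η = proj₁ (proj₂ extension)
          y-i = proj₁ (proj₂ (proj₂ extension))

      endpoints-≤ : ∀ α → α 𝕀.⊥ ≤ α 𝕀.⊤
      endpoints-≤ α with every-path-is-segment α
      ... | (a , b) , a≤b , α≡path
        -- The endpoints of `α` are the coefficients `a` and `b` of its normal form.
        rewrite trans (α≡path 𝕀.⊥) (path-⊥ a b) | trans (α≡path 𝕀.⊤) (path-⊤ a≤b) = a≤b

      path-endpoints : ∀ α t → α t ≡ path (α 𝕀.⊥) (α 𝕀.⊤) t
      path-endpoints α t with every-path-is-segment α
      ... | (a , b) , a≤b , α≡path
        rewrite trans (α≡path 𝕀.⊥) (path-⊥ a b) | trans (α≡path 𝕀.⊤) (path-⊤ a≤b) = α≡path t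

-- The path space as the graph of the order.

theorem7p8 : FunExt → (𝕀 : BDLattice) → SQCP 𝕀 →
    (A : Alg 𝕀) → IsQuasiCoherent 𝕀 A →
    (Ai : Alg 𝕀) (η : AlgHom 𝕀 A Ai) (i : car Ai) → IsFreeOneGen 𝕀 A Ai η i →
    IsQuasiCoherent 𝕀 Ai →
    IsEmbedding (λ (α : Carrier 𝕀 → car A) → (α (BDLattice.⊥ 𝕀) , α (BDLattice.⊤ 𝕀)))
    × (∀ (a b : car A) →
    (fiber (λ (α : Carrier 𝕀 → car A) → (α (BDLattice.⊥ 𝕀) , α (BDLattice.⊤ 𝕀))) (a , b))
    ⇔ BDLattice._≤_ (lat A) a b)
theorem7p8 funExt 𝕀 _ A A-qc Ai η i free Ai-qc = embedding , λ a b → mk⇔ to from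
  where
  endpoints : (Carrier 𝕀 → car A) → car A × car A
  endpoints α = α (BDLattice.⊥ 𝕀) , α (BDLattice.⊤ 𝕀)

  determined : ∀ α t → α t ≡ path A (proj₁ (endpoints α)) (proj₂ (endpoints α)) t
  determined = path-endpoints A funExt A-qc Ai η i free Ai-qc

  fiber-≡ : ∀ {y} {p q : fiber endpoints y} → proj₁ p ≡ proj₁ q → p ≡ q
  fiber-≡ refl = cong (_ ,_) (uip _ _)

  -- By `uip` it suffices that `endpoints` is injective, and `determined` rebuilds each path from
  -- its endpoints.
  embedding : IsEmbedding endpoints
  embedding y (α , e) (β , e') = fiber-≡ (funExt λ t → begin
    α t                                                         ≡⟨ determined α t ⟩
    path A (proj₁ (endpoints α)) (proj₂ (endpoints α)) t
      ≡⟨ cong (λ (a , b) → path A a b t) (trans e (sym e')) ⟩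
    path A (proj₁ (endpoints β)) (proj₂ (endpoints β)) t        ≡⟨ determined β t ⟨
    β t                                                         ∎)

  to : ∀ {a b} → fiber endpoints (a , b) → BDLattice._≤_ (lat A) a b
  to (α , refl) = endpoints-≤ A funExt A-qc Ai η i free Ai-qc α

  from : ∀ {a b} → BDLattice._≤_ (lat A) a b → fiber endpoints (a , b)
  -- The witness is the segment itself; the order enters at the endpoint `⊤`, where the value
  -- `a ∨ b` becomes `b`.
  from {a} {b} a≤b = path A a b , cong₂ _,_ (path-⊥ A a b) (path-⊤ A a≤b)
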